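{- For every integer $m\ge 1$, $\pi^*(C_5^{2m})\le \frac{44}{25}\,5^m$. For every integer $d\ge 1$, $\pi^*(C_5^d)\le \frac{4}{\sqrt5}\,5^{d/2}$; in particular $\pi^*(C_5^d)\in O(\sqrt5^{\,d})$.
   Context: A distribution on a graph $G=(V,E)$ is a function $D:V\to\mathbb{N}$, with size $|D|=\sum_v D(v)$. A pebbling move removes two pebbles from a vertex having at least two pebbles and places one pebble on a neighbor. A distribution is solvable if for every vertex $v$, some sequence of pebbling moves starting from it results in a distribution with at least one pebble on $v$. The optimal pebbling number $\pi^*(G)$ is the minimum size of a solvable distribution on $G$. $C_5^d$ denotes the $d$-fold Cartesian product of the 5-cycle $C_5$ with itself. -}

module Defs where

open import Data.Nat using (ℕ; zero; suc; _+_; _∸_; _≤_)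
open import Data.Fin using (Fin; zero; suc)
import Data.Fin.Properties as FinP
open import Data.Vec using (Vec; []; _∷_)
import Data.Vec.Properties as VecP
open import Data.List using (List; map; allFin)
open import Data.Nat.ListAction using (sum)
open import Data.Product using (∃; _×_; _,_)
open import Relation.Binary.PropositionalEquality using (_≡_)
open import Relation.Nullary using (yes; no)
open import Relation.Binary.Construct.Closure.ReflexiveTransitive using (Star)

next5 : Fin 5 → Fin 5
next5 zero = suc zero
next5 (suc zero) = suc (suc zero)
next5 (suc (suc zero)) = suc (suc (suc zero))
next5 (suc (suc (suc zero))) = suc (suc (suc (suc zero)))
next5 (suc (suc (suc (suc zero)))) = zero

data C5Adj : Fin 5 → Fin 5 → Set where
  fwd : ∀ a → C5Adj a (next5 a)
  bwd : ∀ a → C5Adj (next5 a) a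

Vertex : ℕ → Set
Vertex d = Vec (Fin 5) d

data Adj : ∀ {d} → Vertex d → Vertex d → Set where
  here  : ∀ {d} {a b} (u : Vertex d) → C5Adj a b → Adj (a ∷ u) (b ∷ u)
  there : ∀ {d} {u v : Vertex d} (a : Fin 5) → Adj u v → Adj (a ∷ u) (a ∷ v)

Distribution : ℕ → Set
Distribution d = Vertex d → ℕ

sumV : ∀ d → (Vertex d → ℕ) → ℕ
sumV zero f = f []
sumV (suc d) f = sum (map (λ i → sumV d (λ v → f (i ∷ v))) (allFin 5))

size : ∀ {d} → Distribution d → ℕ
size {d} D = sumV d D

_≟V_ : ∀ {d} (u v : Vertex d) → Relation.Nullary.Dec (u ≡ v)
_≟V_ = VecP.≡-dec FinP._≟_

applyMove : ∀ {d} → Vertex d → Vertex d → Distribution d → Distribution d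
applyMove u v D w with w ≟V u | w ≟V v
... | yes _ | _     = D w ∸ 2
... | no _  | yes _ = suc (D w)
... | no _  | no _  = D w

data Move {d} : Distribution d → Distribution d → Set where
  move : ∀ {D} (u v : Vertex d) → Adj u v → 2 ≤ D u → Move D (applyMove u v D)

Reach : ∀ {d} → Distribution d → Distribution d → Set
Reach = Star Move

Solvable : ∀ {d} → Distribution d → Set
Solvable {d} D = ∀ (r : Vertex d) → ∃ λ D' → Reach D D' × 1 ≤ D' r

{-# OPTIONS --safe #-}

-- A supply of k on C₅ᵈ is a multiset of pebbles from which k pebbles can be brought to any vertex.
-- In a pile of pebbles on C₅ᵉ, each stack of k may be replaced by a supply of k on the fibre C₅ᵈ
-- above it: to reach (x , y), first assemble every stack inside C₅ᵉ × {y}, then follow the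
-- pile's strategy there. On C₅² there are three useful piles: stacks of 4 on the perfect code {(x , 2x)}
-- bring 4 pebbles anywhere, stacks 4, 4, 4 bring 2 pebbles anywhere, and stacks 2, 2, 4 bring 1.
-- Iterating the first gives supplies of 4 on C₅²ᵐ of size 4·5ᵐ, hence by the second supplies of 2
-- of size 12·5ᵐ⁻¹, and by the third solvable distributions on C₅²ᵐ⁺² of size (24 + 20)·5ᵐ⁻¹,
-- with 2 + 2 + 4 pebbles on C₅² itself.
-- In odd dimensions, a stack of 4 on C₅ solves C₅, so C₅²ᵐ⁺¹ is solved by 4·5ᵐ pebbles.

module Submission where

open import Defs
open import Data.Nat using (ℕ; zero; suc; _+_; _*_; _^_; _∸_; _⊓_; ∣_-_∣; ⌊_/2⌋; _≤_; _≤?_; z≤n; s≤s)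
open import Data.Nat.Properties
open import Data.Nat.Tactic.RingSolver using (solve-∀)
open import Data.Bool using (if_then_else_)
open import Data.Empty using (⊥-elim)
open import Data.Fin using (Fin; toℕ)
open import Data.Fin.Patterns
import Data.Fin.Properties as Fin
open import Data.List using (List; []; _∷_; _++_; length; map; replicate)
import Data.List.Properties as List
open import Data.List.Relation.Binary.Permutation.Propositional
  using (_↭_; refl; prep; swap; trans; ↭-refl; ↭-trans)
open import Data.List.Relation.Binary.Permutation.Propositional.Properties using (++-comm; map⁺)
open import Data.List.Relation.Unary.All using (All; []; _∷_; reduce)
open import Data.Nat.ListAction using (sum)
open import Data.Product using (∃; _×_; _,_; proj₁; proj₂)
open import Data.Sum using (_⊎_; inj₁; inj₂)
open import Data.Vec using ([]; _∷_; splitAt) renaming (_++_ to _++ᵛ_)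
open import Data.Vec.Properties using (∷-injectiveˡ; ∷-injectiveʳ)
open import Function using (_∘_)
open import Relation.Binary.Construct.Closure.ReflexiveTransitive using (ε; _◅_; _◅◅_)
open import Relation.Binary.PropositionalEquality
  using (_≡_; _≢_; refl; sym; cong; cong₂; subst)
import Relation.Binary.PropositionalEquality as ≡
open import Relation.Nullary using (¬_; Dec; yes; no)
open import Relation.Nullary.Decidable using (does; from-yes; map′; _⊎-dec_)

-- Pebbling on lists of pebbles

infix 4 _⟶_

-- Each list entry is one pebble, so that strategies can be run side by side with `++` and moved
-- along embeddings with `map`. Rules act at the front, `permute` brings pebbles there, and
-- `discard` lets a delivery be an exact number of pebbles.
data _⟶_ {d} : List (Vertex d) → List (Vertex d) → Set where
  fire    : ∀ {u v l} → Adj u v → u ∷ u ∷ l ⟶ v ∷ l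
  discard : ∀ {u l} → u ∷ l ⟶ l
  permute : ∀ {l l′} → l ↭ l′ → l ⟶ l′
  _then_  : ∀ {l₁ l₂ l₃} → l₁ ⟶ l₂ → l₂ ⟶ l₃ → l₁ ⟶ l₃

infixr 5 _then_

private variable
  d e k n : ℕ

idle : {l : List (Vertex d)} → l ⟶ l
idle = permute ↭-refl

≡⇒⟶ : {l l′ : List (Vertex d)} → l ≡ l′ → l ⟶ l′
≡⇒⟶ refl = idle

∷-mono : (x : Vertex d) {l l′ : List (Vertex d)} → l ⟶ l′ → x ∷ l ⟶ x ∷ l′
∷-mono x (fire {u} {v} adj) =
  permute (↭-trans (swap x u refl) (prep u (swap x u refl))) then fire adj then permute (swap v x refl)
∷-mono x (discard {u})   = permute (swap x u refl) then discard
∷-mono x (permute p)     = permute (prep x p)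
∷-mono x (p then q)      = ∷-mono x p then ∷-mono x q

++-monoʳ : (l : List (Vertex d)) {m m′ : List (Vertex d)} → m ⟶ m′ → l ++ m ⟶ l ++ m′
++-monoʳ []      p = p
++-monoʳ (x ∷ l) p = ∷-mono x (++-monoʳ l p)

++-mono : {l l′ m m′ : List (Vertex d)} → l ⟶ l′ → m ⟶ m′ → l ++ m ⟶ l′ ++ m′
++-mono {l = l} {l′} {m} {m′} p q =
  ++-monoʳ l q then permute (++-comm l m′) then ++-monoʳ m′ p then permute (++-comm m′ l′)

map-mono : (f : Vertex d → Vertex e) → (∀ {u v} → Adj u v → Adj (f u) (f v)) →
           ∀ {l l′} → l ⟶ l′ → map f l ⟶ map f l′
map-mono f hom (fire adj)  = fire (hom adj)
map-mono f hom discard     = discard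
map-mono f hom (permute p) = permute (map⁺ f p)
map-mono f hom (p then q)  = map-mono f hom p then map-mono f hom q

replicate-++ : {A : Set} (m n : ℕ) {x : A} → replicate m x ++ replicate n x ≡ replicate (m + n) x
replicate-++ zero    n = refl
replicate-++ (suc m) n = cong (_ ∷_) (replicate-++ m n)

replicate-≤ : {t : Vertex d} {m n : ℕ} → m ≤ n → replicate n t ⟶ replicate m t
replicate-≤ {n = zero}  z≤n     = idle
replicate-≤ {n = suc n} z≤n     = discard then replicate-≤ {n = n} z≤n
replicate-≤             (s≤s p) = ∷-mono _ (replicate-≤ p)

-- Adjacency in cycles and products

C5Adj-irrefl : ∀ {a} → ¬ C5Adj a a
C5Adj-irrefl p = irrefl p refl
  where
  next≢ : ∀ a → next5 a ≢ a
  next≢ 0F ()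
  next≢ 1F ()
  next≢ 2F ()
  next≢ 3F ()
  next≢ 4F ()
  irrefl : ∀ {a b} → C5Adj a b → a ≢ b
  irrefl (fwd a) eq = next≢ a (sym eq)
  irrefl (bwd a) eq = next≢ a eq

-- `applyMove` tests the source before the target, so a pebble arriving along a loop would be lost;
-- `applyMove-count` has to exclude this.
Adj-irrefl : {u v : Vertex d} → Adj u v → u ≢ v
Adj-irrefl (here u p)  refl = C5Adj-irrefl p
Adj-irrefl (there a p) eq   = Adj-irrefl p (∷-injectiveʳ eq)

Adj-++ˡ : (w : Vertex e) {u v : Vertex d} → Adj u v → Adj (w ++ᵛ u) (w ++ᵛ v)
Adj-++ˡ []      p = p
Adj-++ˡ (a ∷ w) p = there a (Adj-++ˡ w p)

Adj-++ʳ : (w : Vertex d) {u v : Vertex e} → Adj u v → Adj (u ++ᵛ w) (v ++ᵛ w)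
Adj-++ʳ w (here u p)  = here (u ++ᵛ w) p
Adj-++ʳ w (there a p) = there a (Adj-++ʳ w p)

-- From lists of pebbles to distributions

δ : Vertex d → Distribution d
δ u w = if does (w ≟V u) then 1 else 0

count : List (Vertex d) → Distribution d
count []      w = 0
count (u ∷ l) w = δ u w + count l w

δ-refl : (u : Vertex d) → δ u u ≡ 1
δ-refl u with u ≟V u
... | yes _ = refl
... | no ¬p = ⊥-elim (¬p refl)

δ-≢ : {u w : Vertex d} → w ≢ u → δ u w ≡ 0
δ-≢ {u = u} {w} w≢u with w ≟V u
... | yes p = ⊥-elim (w≢u p)
... | no _  = refl

count-↭ : {l l′ : List (Vertex d)} → l ↭ l′ → ∀ w → count l w ≡ count l′ w
count-↭ refl         w = refl
count-↭ (prep x p)   w = cong (δ x w +_) (count-↭ p w)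
count-↭ (swap {l} {l′} x y p) w
  rewrite count-↭ p w = swap-+ (δ x w) (δ y w) (count l′ w)
  where
  swap-+ : ∀ a b c → a + (b + c) ≡ b + (a + c)
  swap-+ = solve-∀
count-↭ (trans p q)  w = ≡.trans (count-↭ p w) (count-↭ q w)

applyMove-count : {u v : Vertex d} {l : List (Vertex d)} {D : Distribution d} → u ≢ v →
                  (∀ w → count (u ∷ u ∷ l) w ≤ D w) →
                  ∀ w → count (v ∷ l) w ≤ applyMove u v D w
applyMove-count {u = u} {v} u≢v h w with w ≟V u | w ≟V v | h w
... | yes refl | yes refl | _ = ⊥-elim (u≢v refl)
... | yes _    | no _     | q = ∸-monoˡ-≤ 2 q
... | no _     | yes _    | q = s≤s q
... | no _     | no _     | q = q

-- The invariant is domination rather than equality: `discard` and `permute` are then realised by no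
-- move at all, with discarded pebbles staying where they are.
realise : {l l′ : List (Vertex d)} → l ⟶ l′ →
          ∀ D → (∀ w → count l w ≤ D w) → ∃ λ D′ → Reach D D′ × (∀ w → count l′ w ≤ D′ w)
realise (fire {u} {v} {l} adj) D h =
  applyMove u v D , move u v adj 2≤Du ◅ ε , applyMove-count {l = l} (Adj-irrefl adj) h
  where
  2≤Du : 2 ≤ D u
  2≤Du = ≤-trans (+-monoʳ-≤ 2 z≤n)
           (subst (λ x → x + (x + count l u) ≤ D u) (δ-refl u) (h u))
realise (discard {u}) D h = D , ε , λ w → ≤-trans (m≤n+m _ (δ u w)) (h w)
realise (permute p)   D h = D , ε , λ w → subst (_≤ D w) (count-↭ p w) (h w)
realise (p then q)    D h =
  let D₁ , r₁ , h₁ = realise p D h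
      D₂ , r₂ , h₂ = realise q D₁ h₁
  in D₂ , r₁ ◅◅ r₂ , h₂

sumV-+ : ∀ d (f g : Vertex d → ℕ) → sumV d (λ v → f v + g v) ≡ sumV d f + sumV d g
sumV-+ zero    f g = refl
sumV-+ (suc d) f g
  rewrite sumV-+ d (f ∘ (0F ∷_)) (g ∘ (0F ∷_))
        | sumV-+ d (f ∘ (1F ∷_)) (g ∘ (1F ∷_))
        | sumV-+ d (f ∘ (2F ∷_)) (g ∘ (2F ∷_))
        | sumV-+ d (f ∘ (3F ∷_)) (g ∘ (3F ∷_))
        | sumV-+ d (f ∘ (4F ∷_)) (g ∘ (4F ∷_))
        = regroup (S f 0F) (S f 1F) (S f 2F) (S f 3F) (S f 4F) (S g 0F) (S g 1F) (S g 2F) (S g 3F) (S g 4F)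
  where
  S : (Vertex (suc d) → ℕ) → Fin 5 → ℕ
  S f a = sumV d (f ∘ (a ∷_))
  regroup : ∀ a b c d e a′ b′ c′ d′ e′ →
    (a + a′) + ((b + b′) + ((c + c′) + ((d + d′) + ((e + e′) + 0)))) ≡
    (a + (b + (c + (d + (e + 0))))) + (a′ + (b′ + (c′ + (d′ + (e′ + 0)))))
  regroup = solve-∀

sumV-zero : ∀ d {f : Vertex d → ℕ} → (∀ v → f v ≡ 0) → sumV d f ≡ 0
sumV-zero zero    f≡0 = f≡0 []
sumV-zero (suc d) f≡0
  rewrite sumV-zero d (f≡0 ∘ (0F ∷_))
        | sumV-zero d (f≡0 ∘ (1F ∷_))
        | sumV-zero d (f≡0 ∘ (2F ∷_))
        | sumV-zero d (f≡0 ∘ (3F ∷_))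
        | sumV-zero d (f≡0 ∘ (4F ∷_))
        = refl

sumV-supported : (u : Vertex d) {f : Vertex d → ℕ} → (∀ {v} → v ≢ u → f v ≡ 0) → sumV d f ≡ f u
sumV-supported []            f≡0 = refl
sumV-supported {suc d} (a ∷ u) {f} f≡0 = pick a (sumV-supported u λ v≢u → f≡0 (v≢u ∘ ∷-injectiveʳ)) off
  where
  S : Fin 5 → ℕ
  S b = sumV d (f ∘ (b ∷_))
  off : ∀ {b} → b ≢ a → S b ≡ 0
  off b≢a = sumV-zero d λ v → f≡0 (b≢a ∘ ∷-injectiveˡ)
  pick : ∀ a → S a ≡ n → (∀ {b} → b ≢ a → S b ≡ 0) → S 0F + (S 1F + (S 2F + (S 3F + (S 4F + 0)))) ≡ n
  pick 0F on off rewrite off {1F} (λ ()) | off {2F} (λ ()) | off {3F} (λ ()) | off {4F} (λ ()) = ≡.trans (+-identityʳ _) on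
  pick 1F on off rewrite off {0F} (λ ()) | off {2F} (λ ()) | off {3F} (λ ()) | off {4F} (λ ()) = ≡.trans (+-identityʳ _) on
  pick 2F on off rewrite off {0F} (λ ()) | off {1F} (λ ()) | off {3F} (λ ()) | off {4F} (λ ()) = ≡.trans (+-identityʳ _) on
  pick 3F on off rewrite off {0F} (λ ()) | off {1F} (λ ()) | off {2F} (λ ()) | off {4F} (λ ()) = ≡.trans (+-identityʳ _) on
  pick 4F on off rewrite off {0F} (λ ()) | off {1F} (λ ()) | off {2F} (λ ()) | off {3F} (λ ()) = ≡.trans (+-identityʳ _) on

size-count : (l : List (Vertex d)) → size (count l) ≡ length l
size-count {d} []      = sumV-zero d λ _ → refl
size-count {d} (u ∷ l) = ≡.trans (sumV-+ d (δ u) (count l))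
  (cong₂ _+_ (≡.trans (sumV-supported u δ-≢) (δ-refl u)) (size-count l))

-- Supplies and their products

Stack : ℕ → Set
Stack d = Vertex d × ℕ

spread : List (Stack d) → List (Vertex d)
spread []            = []
spread ((u , n) ∷ s) = replicate n u ++ spread s

spread-++ : (s s′ : List (Stack d)) → spread (s ++ s′) ≡ spread s ++ spread s′
spread-++ []            s′ = refl
spread-++ ((u , n) ∷ s) s′ =
  ≡.trans (cong (replicate n u ++_) (spread-++ s s′)) (sym (List.++-assoc (replicate n u) _ _))

record Supply (d k n : ℕ) : Set where
  field
    pebbles  : List (Vertex d)
    length≡  : length pebbles ≡ n
    delivers : ∀ t → pebbles ⟶ replicate k t
open Supply

supply⇒solvable : Supply d 1 n → ∃ λ (D : Distribution d) → Solvable D × size D ≡ n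
supply⇒solvable s = count (pebbles s) , solvable , ≡.trans (size-count (pebbles s)) (length≡ s)
  where
  solvable : Solvable (count (pebbles s))
  solvable t =
    let D′ , reach , h = realise (delivers s t) _ (λ _ → ≤-refl)
    in D′ , reach , ≤-trans (≤-trans (≤-reflexive (sym (δ-refl t))) (m≤m+n _ _)) (h t)

point : ∀ k → Supply 0 k k
point k .pebbles     = replicate k []
point k .length≡     = List.length-replicate k
point k .delivers [] = idle

Supplies : ℕ → List (Stack e) → Set
Supplies d = All (λ (u , k) → ∃ (Supply d k))

product : {s : List (Stack e)} → (∀ t → spread s ⟶ replicate k t) →
          (A : Supplies d s) → Supply (e + d) k (sum (reduce proj₁ A))
product {e} {k} {d} gather A = record { pebbles = place A ; length≡ = length-place A ; delivers = deliver }
  where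
  place : ∀ {s} → Supplies d s → List (Vertex (e + d))
  place []                      = []
  place (_∷_ {u , _} (_ , S) A) = map (u ++ᵛ_) (pebbles S) ++ place A

  length-place : ∀ {s} (A : Supplies d s) → length (place A) ≡ sum (reduce proj₁ A)
  length-place []                      = refl
  length-place (_∷_ {u , _} (n , S) A) = ≡.trans (List.length-++ (map (u ++ᵛ_) (pebbles S)))
    (cong₂ _+_ (≡.trans (List.length-map (u ++ᵛ_) (pebbles S)) (length≡ S)) (length-place A))

  collect : ∀ {s} (A : Supplies d s) (y : Vertex d) → place A ⟶ map (_++ᵛ y) (spread s)
  collect []                            y = idle
  collect (_∷_ {u , k} {s} (_ , S) A) y =
    ++-mono (map-mono (u ++ᵛ_) (Adj-++ˡ u) (delivers S y) then ≡⇒⟶ eq) (collect A y)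
    then ≡⇒⟶ (sym (List.map-++ (_++ᵛ y) (replicate k u) (spread s)))
    where
    -- The k pebbles delivered to (u , y) within the fibre above u are at the same time the pile's
    -- stack at u within the layer of y.
    eq : map (u ++ᵛ_) (replicate k y) ≡ map (_++ᵛ y) (replicate k u)
    eq = ≡.trans (List.map-replicate (u ++ᵛ_) k y) (sym (List.map-replicate (_++ᵛ y) k u))

  deliver : ∀ t → place A ⟶ replicate k t
  deliver t with splitAt e t
  ... | x , y , refl =
    collect A y then map-mono (_++ᵛ y) (Adj-++ʳ y) (gather x) then ≡⇒⟶ (List.map-replicate (_++ᵛ y) k x)

-- Transport of stacks along shortest paths

halve : ℕ → ℕ → ℕ
halve zero    n = n
halve (suc i) n = halve i ⌊ n /2⌋

halve-move : {u v : Vertex d} → Adj u v → ∀ n → replicate n u ⟶ replicate ⌊ n /2⌋ v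
halve-move adj zero          = idle
halve-move adj (suc zero)    = discard
halve-move adj (suc (suc n)) = fire adj then ∷-mono _ (halve-move adj n)

spin : ℕ → Fin 5 → Fin 5
spin zero    a = a
spin (suc i) a = spin i (next5 a)

dist : Fin 5 → Fin 5 → ℕ
dist a b = ∣ toℕ a - toℕ b ∣ ⊓ (5 ∸ ∣ toℕ a - toℕ b ∣)

-- `spin` turns only forward, so the shorter arc is a forward path either from a to b or from b to
-- a. The 25 pairs are checked by evaluation.
dist-spin : ∀ a b → spin (dist a b) a ≡ b ⊎ spin (dist a b) b ≡ a
dist-spin = from-yes (Fin.all? λ a → Fin.all? λ b →
  (spin (dist a b) a Fin.≟ b) ⊎-dec (spin (dist a b) b Fin.≟ a))

rotate : (u : Vertex d) → ∀ a b n → replicate n (a ∷ u) ⟶ replicate (halve (dist a b) n) (b ∷ u)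
rotate u a b n with dist a b | dist-spin a b
... | i | inj₁ refl = forward i a n
  where
  forward : ∀ i a n → replicate n (a ∷ u) ⟶ replicate (halve i n) (spin i a ∷ u)
  forward zero    a n = idle
  forward (suc i) a n = halve-move (here u (fwd a)) n then forward i (next5 a) ⌊ n /2⌋
... | i | inj₂ refl = backward i b n
  where
  halve-⌊⌋ : ∀ i n → ⌊ halve i n /2⌋ ≡ halve (suc i) n
  halve-⌊⌋ zero    n = refl
  halve-⌊⌋ (suc i) n = halve-⌊⌋ i ⌊ n /2⌋
  backward : ∀ i b n → replicate n (spin i b ∷ u) ⟶ replicate (halve i n) (b ∷ u)
  backward zero    b n = idle
  -- The step into b comes last, so here the halving is outermost, whereas `halve` halves innermost;
  -- `halve-⌊⌋` reconciles the two.
  backward (suc i) b n = backward i (next5 b) n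
    then halve-move (here u (bwd b)) (halve i n)
    then ≡⇒⟶ (cong (λ m → replicate m (b ∷ u)) (halve-⌊⌋ i n))

-- Coordinates are corrected one at a time. Since successive roundings down compose, this is ⌊n /
-- 2^δ⌋ with δ the distance from u to v.
arriving : Stack d → Vertex d → ℕ
arriving ([]    , n) []      = n
arriving (a ∷ u , n) (b ∷ v) = arriving (u , halve (dist a b) n) v

carry : (u v : Vertex d) → ∀ n → replicate n u ⟶ replicate (arriving (u , n) v) v
carry []      []      n = idle
carry (a ∷ u) (b ∷ v) n =
  rotate u a b n
  then ≡⇒⟶ (sym (List.map-replicate (b ∷_) m u))
  then map-mono (b ∷_) (there b) (carry u v m)
  then ≡⇒⟶ (List.map-replicate (b ∷_) _ v)
  where m = halve (dist a b) n

-- Gathering piles, with a finite check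

gathered : List (Stack d) → Vertex d → ℕ
gathered s p = sum (map (λ x → arriving x p) s)

gather : (s : List (Stack d)) (p : Vertex d) → spread s ⟶ replicate (gathered s p) p
gather []            p = idle
gather ((u , n) ∷ s) p = ++-mono (carry u p n) (gather s p) then ≡⇒⟶ (replicate-++ (arriving (u , n) p) _)

-- The stacks s are first merged at p, which avoids losing their remainders on the way to t.
relayed : List (Stack d) → List (Stack d) → Vertex d → Vertex d → ℕ
relayed s s′ p t = gathered ((p , gathered s p) ∷ s′) t

-- The meeting point p may depend on t. Taking p = t sends every stack directly, as does an empty
-- `s`, which leaves an empty stack at p. The hypothesis only compares numbers, so `relays?` settles
-- it by search.
relay : (s s′ : List (Stack d)) → (∀ t → ∃ λ p → k ≤ relayed s s′ p t) →
        ∀ t → spread (s ++ s′) ⟶ replicate k t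
relay s s′ enough t =
  let p , k≤ = enough t
  in ≡⇒⟶ (spread-++ s s′) then ++-mono (gather s p) idle
     then gather ((p , gathered s p) ∷ s′) t then replicate-≤ k≤

allV? : {P : Vertex d → Set} → (∀ v → Dec (P v)) → Dec (∀ v → P v)
allV? {zero}  P? = map′ (λ p → λ { [] → p }) (λ f → f []) (P? [])
allV? {suc d} P? = map′ (λ f → λ { (a ∷ v) → f a v }) (λ f a v → f (a ∷ v))
                        (Fin.all? λ a → allV? λ v → P? (a ∷ v))

anyV? : {P : Vertex d → Set} → (∀ v → Dec (P v)) → Dec (∃ P)
anyV? {zero}  P? = map′ ([] ,_) (λ { ([] , p) → p }) (P? [])
anyV? {suc d} P? = map′ (λ (a , v , p) → a ∷ v , p) (λ { (a ∷ v , p) → a , v , p })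
                        (Fin.any? λ a → anyV? λ v → P? (a ∷ v))

relays? : ∀ k (s s′ : List (Stack d)) → Dec (∀ t → ∃ λ p → k ≤ relayed s s′ p t)
relays? k s s′ = allV? λ t → anyV? λ p → k ≤? relayed s s′ p t

-- The three piles on C₅²

stack : Fin 5 → Fin 5 → ℕ → Stack 2
stack a b n = a ∷ b ∷ [] , n

-- A non-codeword has one codeword at distance 1 and two at distance 2,
-- so it receives 4/2 + 4/4 + 4/4 pebbles.
module Four where
  code : List (Stack 2)
  code = stack 0F 0F 4 ∷ stack 1F 2F 4 ∷ stack 2F 4F 4 ∷ stack 3F 1F 4 ∷ stack 4F 3F 4 ∷ []

  gathers : ∀ t → spread code ⟶ replicate 4 t
  gathers = relay [] code (from-yes (relays? 4 [] code))

  extend : Supply d 4 n → Supply (2 + d) 4 (5 * n)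
  extend S = product gathers ((_ , S) ∷ (_ , S) ∷ (_ , S) ∷ (_ , S) ∷ (_ , S) ∷ [])

module Two where
  near far : List (Stack 2)
  near = stack 0F 0F 4 ∷ stack 1F 1F 4 ∷ []
  far  = stack 3F 3F 4 ∷ []

  -- Sent directly, the stacks bring 2 pebbles to every vertex except (2,4) and (4,2), which get
  -- one, from `far`. For these, `near` first puts 2 + 2 pebbles on (1,0) or (0,1) respectively, two
  -- steps from the target, and so supplies the second.
  gathers : ∀ t → spread (near ++ far) ⟶ replicate 2 t
  gathers = relay near far (from-yes (relays? 2 near far))

  extend : Supply d 4 n → Supply (2 + d) 2 (3 * n)
  extend S = product gathers ((_ , S) ∷ (_ , S) ∷ (_ , S) ∷ [])

module One where
  near far : List (Stack 2)
  near = stack 2F 2F 2 ∷ stack 3F 3F 2 ∷ []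
  far  = stack 0F 0F 4 ∷ []

  -- The stack at (0,0) reaches distance 2, and each stack of `near` reaches distance 1. The
  -- vertices left over, (1,3), (2,4), (3,1) and (4,2), are adjacent to (2,3) or (3,2), where the
  -- stacks of `near` merge into 2 pebbles.
  gathers : ∀ t → spread (near ++ far) ⟶ replicate 1 t
  gathers = relay near far (from-yes (relays? 1 near far))

  extend : ∀ {m} → Supply d 2 m → Supply d 4 n → Supply (2 + d) 1 (m + (m + (n + 0)))
  extend S₂ S₄ = product gathers ((_ , S₂) ∷ (_ , S₂) ∷ (_ , S₄) ∷ [])

-- Iteration and the size bounds

fourSize : ℕ → ℕ
fourSize zero    = 4
fourSize (suc m) = 5 * fourSize m

-- With the dimension written `m * 2`, each step computes to `2 + m * 2`, as `Four.extend` requires.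
four : ∀ m → Supply (m * 2) 4 (fourSize m)
four zero    = point 4
four (suc m) = Four.extend (four m)

fourSize≡ : ∀ m → fourSize m ≡ 4 * 5 ^ m
fourSize≡ zero    = refl
fourSize≡ (suc m) = ≡.trans (cong (5 *_) (fourSize≡ m)) (eq (5 ^ m))
  where
  eq : ∀ x → 5 * (4 * x) ≡ 4 * (5 * x)
  eq = solve-∀

SolvableWithSize : ℕ → (ℕ → Set) → Set
SolvableWithSize d P = ∃ λ (D : Distribution d) → Solvable D × P (size D)

solvableWithSize : (P : ℕ → Set) → Supply d 1 n → P n → SolvableWithSize d P
solvableWithSize P S p =
  let D , solvable , size≡ = supply⇒solvable S in D , solvable , subst P (sym size≡) p

relax : {P Q : ℕ → Set} → (∀ s → P s → Q s) → SolvableWithSize d P → SolvableWithSize d Q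
relax P⇒Q (D , solvable , p) = D , solvable , P⇒Q (size D) p

even : ∀ m → SolvableWithSize (suc m * 2) (λ s → 25 * s ≤ 44 * 5 ^ suc m)
-- `Two.extend` would already use up both dimensions, so the stacks stay as they are: 25 · 8 = 200
-- against 44 · 5 = 220.
even zero    = solvableWithSize (λ s → 25 * s ≤ 44 * 5 ^ 1) (One.extend (point 2) (point 4)) (from-yes (200 ≤? 220))
even (suc m) = solvableWithSize (λ s → 25 * s ≤ 44 * 5 ^ (2 + m))
  (One.extend (Two.extend (four m)) (four (suc m))) (≤-reflexive bound)
  where
  eq : ∀ x → 25 * (3 * (4 * x) + (3 * (4 * x) + (5 * (4 * x) + 0))) ≡ 44 * (5 * (5 * x))
  eq = solve-∀
  bound : 25 * (3 * fourSize m + (3 * fourSize m + (5 * fourSize m + 0))) ≡ 44 * 5 ^ (2 + m)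
  bound rewrite fourSize≡ m = eq (5 ^ m)

odd : ∀ m → SolvableWithSize (suc (m * 2)) (λ s → s ≡ 4 * 5 ^ m)
odd m = solvableWithSize (_≡ 4 * 5 ^ m) (product gathers ((_ , four m) ∷ [])) (≡.trans (+-identityʳ _) (fourSize≡ m))
  where
  origin : List (Stack 1)
  -- C₅ has diameter 2, and 4 pebbles survive two halvings as one.
  origin = (0F ∷ [] , 4) ∷ []
  gathers : ∀ t → spread origin ⟶ replicate 1 t
  gathers = relay [] origin (from-yes (relays? 1 [] origin))

square-5^ : ∀ m → 5 ^ (m * 2) ≡ 5 ^ m * 5 ^ m
square-5^ m = ≡.trans (sym (^-*-assoc 5 m 2)) (cong (5 ^ m *_) (*-identityʳ (5 ^ m)))

-- The bound (4/√5)·5^(d/2) is squared to stay within ℕ. It exceeds 44/25 · 5^m because 5 · 44² =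
-- 9680 and 16 · 25² = 10000; the factor 625 clears the denominators.
even-square : ∀ m s → 25 * s ≤ 44 * 5 ^ m → 5 * (s * s) ≤ 16 * 5 ^ (m * 2)
even-square m s h = *-cancelˡ-≤ 625 (begin
  625 * (5 * (s * s))                 ≡⟨ eq₁ s ⟩
  5 * ((25 * s) * (25 * s))           ≤⟨ *-monoʳ-≤ 5 (*-mono-≤ h h) ⟩
  5 * ((44 * x) * (44 * x))           ≡⟨ eq₂ x ⟩
  9680 * (x * x)                      ≤⟨ *-monoˡ-≤ (x * x) (from-yes (9680 ≤? 10000)) ⟩
  10000 * (x * x)                     ≡⟨ *-assoc 625 16 (x * x) ⟩
  625 * (16 * (x * x))                ≡⟨ cong (λ y → 625 * (16 * y)) (sym (square-5^ m)) ⟩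
  625 * (16 * 5 ^ (m * 2))            ∎)
  where
  open ≤-Reasoning
  x = 5 ^ m
  eq₁ : ∀ s → 625 * (5 * (s * s)) ≡ 5 * ((25 * s) * (25 * s))
  eq₁ = solve-∀
  eq₂ : ∀ x → 5 * ((44 * x) * (44 * x)) ≡ 9680 * (x * x)
  eq₂ = solve-∀

-- In odd dimensions the size 4 · 5^m meets the squared bound with equality.
odd-square : ∀ m s → s ≡ 4 * 5 ^ m → 5 * (s * s) ≤ 16 * 5 ^ suc (m * 2)
odd-square m _ refl rewrite square-5^ m = ≤-reflexive (eq (5 ^ m))
  where
  eq : ∀ x → 5 * ((4 * x) * (4 * x)) ≡ 16 * (5 * (x * x))
  eq = solve-∀

parity : ∀ d → ∃ λ m → d ≡ m * 2 ⊎ d ≡ suc (m * 2)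
parity zero    = 0 , inj₁ refl
parity (suc d) with parity d
... | m , inj₁ refl = m , inj₂ refl
... | m , inj₂ refl = suc m , inj₁ refl

theorem5p5 : ((m : ℕ) → 1 ≤ m →
    ∃ λ (D : Distribution (2 * m)) → Solvable D × 25 * size D ≤ 44 * 5 ^ m)
    × ((d : ℕ) → 1 ≤ d →
    ∃ λ (D : Distribution d) → Solvable D × 5 * (size D * size D) ≤ 16 * 5 ^ d)
theorem5p5 = evens , all
  where
  evens : ∀ m → 1 ≤ m → SolvableWithSize (2 * m) (λ s → 25 * s ≤ 44 * 5 ^ m)
  evens (suc m) _ = subst (λ d → SolvableWithSize d (λ s → 25 * s ≤ 44 * 5 ^ suc m)) (*-comm (suc m) 2) (even m)

  all : ∀ d → 1 ≤ d → SolvableWithSize d (λ s → 5 * (s * s) ≤ 16 * 5 ^ d)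
  all d 1≤d with parity d
  all _ ()  | zero  , inj₁ refl
  all _ _   | suc m , inj₁ refl = relax (even-square (suc m)) (even m)
  all _ _   | m     , inj₂ refl = relax (odd-square m) (odd m)
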